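{- The following is provable in $\mathrm{HA}^\omega$ together with the defining equation of $\mathsf{eps}$. For any $q\colon X^{\mathbb{N}}\to R$, any $\omega\colon X^{\mathbb{N}}\to\mathbb{N}$ and any sequence of selection functions $\varepsilon_n\colon J_RX$ ($n\in\mathbb{N}$, of common type $J_RX$), there are $n\colon\mathbb{N}$, $\alpha\colon\mathbb{N}\to X$ and $p\colon X\to R$ satisfying Spector's system of equations $$n=\omega(\alpha),\qquad \alpha(n)=\varepsilon_n(p),\qquad p(\alpha(n))=q(\alpha).$$
   Context: $X,R$ are arbitrary finite types (generated from booleans $\mathbb{B}$ and $\mathbb{N}$ by products, function types and finite sequence types); $X^{\mathbb{N}}$ is $\mathbb{N}\to X$. $\mathrm{HA}^\omega$ is Heyting arithmetic in all finite types with fully extensional equality (Troelstra's E-$\mathrm{HA}^\omega$). $J_RX=(X\to R)\to X$. $\mathbf{0}$ is the canonical zero object of each type. $*$ is concatenation, $q_x(\beta)=q(x*\beta)$. $\mathsf{eps}$ (available at all finite types $X$, $R$). For $\varepsilon\colon\mathbb{N}\to J_RX$, $\ell\colon R\to\mathbb{N}$, $n\colon\mathbb{N}$, $q\colon X^{\mathbb{N}}\to R$, the value $\mathsf{eps}^\ell_n(\varepsilon)(q)\colon X^{\mathbb{N}}$ is specified by: $\mathsf{eps}^\ell_n(\varepsilon)(q)=\mathbf{0}$ if $\ell(q(\mathbf{0}))<n$, and otherwise $\mathsf{eps}^\ell_n(\varepsilon)(q)=c*\mathsf{eps}^\ell_{n+1}(\varepsilon)(q_c)$, where $c=\varepsilon_n(\lambda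 x.\,q_x(\mathsf{eps}^\ell_{n+1}(\varepsilon)(q_x)))$. -}

module Defs where

open import Data.List.Base using (List; []; _∷_; map)
open import Data.List.Membership.Propositional using (_∈_)
open import Data.List.Relation.Unary.Any using (here; there)
open import Relation.Binary.PropositionalEquality using (refl)

-- A deep embedding of E-HA^ω (intuitionistic, intrinsically typed, de Bruijn
-- variables) in a language with an extra constant eps.

infixr 7 _⇒_
infixr 8 _⊗_

data Ty : Set where
  bool nat : Ty
  _⊗_ _⇒_  : Ty → Ty → Ty
  seq      : Ty → Ty

J : Ty → Ty → Ty
J R X = (X ⇒ R) ⇒ X

Ctx : Set
Ctx = List Ty

private variable
  Γ Δ : Ctx
  X Y R : Ty

-- O, S, nil, cons and the recursors are the usual Gödel primitives; eps takes
-- its arguments in the order ℓ, n, ε, q.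
data Con : Ty → Set where
  true false : Con bool
  cond    : Con (X ⇒ X ⇒ bool ⇒ X)
  O       : Con nat
  S       : Con (nat ⇒ nat)
  natrec  : Con (X ⇒ (nat ⇒ X ⇒ X) ⇒ nat ⇒ X)
  pair    : Con (X ⇒ Y ⇒ X ⊗ Y)
  fst     : Con (X ⊗ Y ⇒ X)
  snd     : Con (X ⊗ Y ⇒ Y)
  nil     : Con (seq X)
  cons    : Con (X ⇒ seq X ⇒ seq X)
  seqrec  : Con (Y ⇒ (X ⇒ seq X ⇒ Y ⇒ Y) ⇒ seq X ⇒ Y)
  eps     : Con ((R ⇒ nat) ⇒ nat ⇒ (nat ⇒ J R X) ⇒ ((nat ⇒ X) ⇒ R) ⇒ (nat ⇒ X))

infixl 9 _·_
infixr 4 ƛ_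

data Tm (Γ : Ctx) : Ty → Set where
  var : X ∈ Γ → Tm Γ X
  con : Con X → Tm Γ X
  ƛ_  : Tm (X ∷ Γ) Y → Tm Γ (X ⇒ Y)
  _·_ : Tm Γ (X ⇒ Y) → Tm Γ X → Tm Γ Y

infix  6 _≐_
infixr 5 _∧_
infixr 4 _∨_
infixr 3 _⊃_
infixr 2 ∀[_]_ ∃[_]_

data Fm (Γ : Ctx) : Set where
  _≐_         : Tm Γ X → Tm Γ X → Fm Γ
  ⊥           : Fm Γ
  _∧_ _∨_ _⊃_ : Fm Γ → Fm Γ → Fm Γ
  ∀[_]_ ∃[_]_ : (X : Ty) → Fm (X ∷ Γ) → Fm Γ

infix 6 ¬_

¬_ : Fm Γ → Fm Γ
¬ φ = φ ⊃ ⊥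

Ren : Ctx → Ctx → Set
Ren Γ Δ = ∀ {X} → X ∈ Γ → X ∈ Δ

liftRen : Ren Γ Δ → Ren (Y ∷ Γ) (Y ∷ Δ)
liftRen ρ (here e)  = here e
liftRen ρ (there x) = there (ρ x)

ren : Ren Γ Δ → Tm Γ X → Tm Δ X
ren ρ (var x) = var (ρ x)
ren ρ (con c) = con c
ren ρ (ƛ t)   = ƛ ren (liftRen ρ) t
ren ρ (s · t) = ren ρ s · ren ρ t

wk : Tm Γ X → Tm (Y ∷ Γ) X
wk = ren there

Sub : Ctx → Ctx → Set
Sub Γ Δ = ∀ {X} → X ∈ Γ → Tm Δ X

infixr 5 _▹_

_▹_ : Tm Δ Y → Sub Γ Δ → Sub (Y ∷ Γ) Δ
(t ▹ σ) (here refl) = t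
(t ▹ σ) (there x)   = σ x

liftSub : Sub Γ Δ → Sub (Y ∷ Γ) (Y ∷ Δ)
liftSub σ (here e)  = var (here e)
liftSub σ (there x) = wk (σ x)

sub : Sub Γ Δ → Tm Γ X → Tm Δ X
sub σ (var x) = σ x
sub σ (con c) = con c
sub σ (ƛ t)   = ƛ sub (liftSub σ) t
sub σ (s · t) = sub σ s · sub σ t

renF : Ren Γ Δ → Fm Γ → Fm Δ
renF ρ (s ≐ t)    = ren ρ s ≐ ren ρ t
renF ρ ⊥          = ⊥
renF ρ (φ ∧ ψ)    = renF ρ φ ∧ renF ρ ψ
renF ρ (φ ∨ ψ)    = renF ρ φ ∨ renF ρ ψ
renF ρ (φ ⊃ ψ)    = renF ρ φ ⊃ renF ρ ψ
renF ρ (∀[ X ] φ) = ∀[ X ] renF (liftRen ρ) φ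
renF ρ (∃[ X ] φ) = ∃[ X ] renF (liftRen ρ) φ

wkF : Fm Γ → Fm (Y ∷ Γ)
wkF = renF there

subF : Sub Γ Δ → Fm Γ → Fm Δ
subF σ (s ≐ t)    = sub σ s ≐ sub σ t
subF σ ⊥          = ⊥
subF σ (φ ∧ ψ)    = subF σ φ ∧ subF σ ψ
subF σ (φ ∨ ψ)    = subF σ φ ∨ subF σ ψ
subF σ (φ ⊃ ψ)    = subF σ φ ⊃ subF σ ψ
subF σ (∀[ X ] φ) = ∀[ X ] subF (liftSub σ) φ
subF σ (∃[ X ] φ) = ∃[ X ] subF (liftSub σ) φ

infixl 10 _[_]

_[_] : Fm (Y ∷ Γ) → Tm Γ Y → Fm Γ
φ [ t ] = subF (t ▹ var) φ

v0 : ∀ {A} → Tm (A ∷ Γ) A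
v0 = var (here refl)

v1 : ∀ {A B} → Tm (B ∷ A ∷ Γ) A
v1 = wk v0

v2 : ∀ {A B C} → Tm (C ∷ B ∷ A ∷ Γ) A
v2 = wk v1

v3 : ∀ {A B C D} → Tm (D ∷ C ∷ B ∷ A ∷ Γ) A
v3 = wk v2

v4 : ∀ {A B C D E} → Tm (E ∷ D ∷ C ∷ B ∷ A ∷ Γ) A
v4 = wk v3

v5 : ∀ {A B C D E F} → Tm (F ∷ E ∷ D ∷ C ∷ B ∷ A ∷ Γ) A
v5 = wk v4

𝟎 : ∀ X → Tm Γ X
𝟎 bool    = con false
𝟎 nat     = con O
𝟎 (X ⊗ Y) = con pair · 𝟎 X · 𝟎 Y
𝟎 (X ⇒ Y) = ƛ 𝟎 Y
𝟎 (seq X) = con nil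

infixl 8 _+_
infix  6 _<_

_+_ : Tm Γ nat → Tm Γ nat → Tm Γ nat
m + n = con natrec · m · (ƛ ƛ con S · v0) · n

_<_ : Tm Γ nat → Tm Γ nat → Fm Γ
m < n = ∃[ nat ] wk m + con S · v0 ≐ wk n

-- (x * β)(0) = x and (x * β)(k + 1) = β(k).
infixr 8 _*_

_*_ : Tm Γ X → Tm Γ (nat ⇒ X) → Tm Γ (nat ⇒ X)
x * β = con natrec · x · (ƛ ƛ wk (wk β) · v1)

-- q after x is the shifted functional q_x = λ β. q (x * β).
_after_ : Tm Γ ((nat ⇒ X) ⇒ R) → Tm Γ X → Tm Γ ((nat ⇒ X) ⇒ R)
q after x = ƛ wk q · (wk x * v0)

EpsEq : Tm Γ (R ⇒ nat) → Tm Γ nat → Tm Γ (nat ⇒ J R X) → Tm Γ ((nat ⇒ X) ⇒ R) → Fm Γ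
EpsEq {X = X} ℓ n ε q =
    (ℓ · (q · 𝟎 (nat ⇒ X)) < n ⊃ con eps · ℓ · n · ε · q ≐ 𝟎 (nat ⇒ X))
  ∧ (¬ (ℓ · (q · 𝟎 (nat ⇒ X)) < n) ⊃
       con eps · ℓ · n · ε · q ≐ c * (con eps · ℓ · (con S · n) · ε · (q after c)))
  where
  c = ε · n · (ƛ wk q after v0 · (con eps · wk ℓ · (con S · wk n) · wk ε · (wk q after v0)))

infix 1 _⊢_

-- Natural deduction for E-HA^ω plus the defining equation of eps (eps-eq).
-- Equality is primitive at every type, with replacement and extensionality.
data _⊢_ {Γ : Ctx} (Θ : List (Fm Γ)) : Fm Γ → Set where
  hyp : ∀ {φ} → φ ∈ Θ → Θ ⊢ φ
  ⊥E  : ∀ {φ} → Θ ⊢ ⊥ → Θ ⊢ φ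
  ∧I  : ∀ {φ ψ} → Θ ⊢ φ → Θ ⊢ ψ → Θ ⊢ φ ∧ ψ
  ∧E₁ : ∀ {φ ψ} → Θ ⊢ φ ∧ ψ → Θ ⊢ φ
  ∧E₂ : ∀ {φ ψ} → Θ ⊢ φ ∧ ψ → Θ ⊢ ψ
  ∨I₁ : ∀ {φ ψ} → Θ ⊢ φ → Θ ⊢ φ ∨ ψ
  ∨I₂ : ∀ {φ ψ} → Θ ⊢ ψ → Θ ⊢ φ ∨ ψ
  ∨E  : ∀ {φ ψ χ} → Θ ⊢ φ ∨ ψ → φ ∷ Θ ⊢ χ → ψ ∷ Θ ⊢ χ → Θ ⊢ χ
  ⊃I  : ∀ {φ ψ} → φ ∷ Θ ⊢ ψ → Θ ⊢ φ ⊃ ψ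
  ⊃E  : ∀ {φ ψ} → Θ ⊢ φ ⊃ ψ → Θ ⊢ φ → Θ ⊢ ψ
  ∀I  : ∀ {φ : Fm (X ∷ Γ)} → map wkF Θ ⊢ φ → Θ ⊢ ∀[ X ] φ
  ∀E  : ∀ {φ : Fm (X ∷ Γ)} → Θ ⊢ ∀[ X ] φ → (t : Tm Γ X) → Θ ⊢ φ [ t ]
  ∃I  : ∀ {φ : Fm (X ∷ Γ)} (t : Tm Γ X) → Θ ⊢ φ [ t ] → Θ ⊢ ∃[ X ] φ
  ∃E  : ∀ {φ : Fm (X ∷ Γ)} {ψ} → Θ ⊢ ∃[ X ] φ → φ ∷ map wkF Θ ⊢ wkF ψ → Θ ⊢ ψ

  ≐-refl  : {t : Tm Γ X} → Θ ⊢ t ≐ t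
  ≐-subst : (φ : Fm (X ∷ Γ)) {s t : Tm Γ X} → Θ ⊢ s ≐ t → Θ ⊢ φ [ s ] → Θ ⊢ φ [ t ]
  ext     : {f g : Tm Γ (X ⇒ Y)} → Θ ⊢ ∀[ X ] wk f · v0 ≐ wk g · v0 → Θ ⊢ f ≐ g
  β       : (t : Tm (X ∷ Γ) Y) (s : Tm Γ X) → Θ ⊢ (ƛ t) · s ≐ sub (s ▹ var) t

  cond-true  : {x y : Tm Γ X} → Θ ⊢ con cond · x · y · con true ≐ x
  cond-false : {x y : Tm Γ X} → Θ ⊢ con cond · x · y · con false ≐ y
  bool-ind   : (φ : Fm (bool ∷ Γ)) →
               Θ ⊢ φ [ con true ] → Θ ⊢ φ [ con false ] → Θ ⊢ ∀[ bool ] φ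

  S≢O      : {n : Tm Γ nat} → Θ ⊢ ¬ (con S · n ≐ con O)
  S-inj    : {m n : Tm Γ nat} → Θ ⊢ con S · m ≐ con S · n ⊃ m ≐ n
  natrec-O : {x : Tm Γ X} {f : Tm Γ (nat ⇒ X ⇒ X)} → Θ ⊢ con natrec · x · f · con O ≐ x
  natrec-S : {x : Tm Γ X} {f : Tm Γ (nat ⇒ X ⇒ X)} {n : Tm Γ nat} →
             Θ ⊢ con natrec · x · f · (con S · n) ≐ f · n · (con natrec · x · f · n)
  nat-ind  : (φ : Fm (nat ∷ Γ)) →
             Θ ⊢ φ [ con O ] →
             Θ ⊢ ∀[ nat ] (φ ⊃ subF (con S · v0 ▹ λ x → var (there x)) φ) →
             Θ ⊢ ∀[ nat ] φ

  fst-pair : {x : Tm Γ X} {y : Tm Γ Y} → Θ ⊢ con fst · (con pair · x · y) ≐ x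
  snd-pair : {x : Tm Γ X} {y : Tm Γ Y} → Θ ⊢ con snd · (con pair · x · y) ≐ y
  pair-η   : {z : Tm Γ (X ⊗ Y)} → Θ ⊢ con pair · (con fst · z) · (con snd · z) ≐ z

  seqrec-nil  : {y : Tm Γ Y} {f : Tm Γ (X ⇒ seq X ⇒ Y ⇒ Y)} →
                Θ ⊢ con seqrec · y · f · con nil ≐ y
  seqrec-cons : {y : Tm Γ Y} {f : Tm Γ (X ⇒ seq X ⇒ Y ⇒ Y)} {x : Tm Γ X} {s : Tm Γ (seq X)} →
                Θ ⊢ con seqrec · y · f · (con cons · x · s)
                      ≐ f · x · s · (con seqrec · y · f · s)
  seq-ind     : (φ : Fm (seq X ∷ Γ)) →
                Θ ⊢ φ [ con nil ] →
                Θ ⊢ ∀[ seq X ] ∀[ X ]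
                      (wkF φ ⊃ subF (con cons · v0 · v1 ▹ λ x → var (there (there x))) φ) →
                Θ ⊢ ∀[ seq X ] φ

  eps-eq : (ℓ : Tm Γ (R ⇒ nat)) (n : Tm Γ nat)
           (ε : Tm Γ (nat ⇒ J R X)) (q : Tm Γ ((nat ⇒ X) ⇒ R)) → Θ ⊢ EpsEq ℓ n ε q

SpectorSystem : Tm Γ ((nat ⇒ X) ⇒ R) → Tm Γ ((nat ⇒ X) ⇒ nat) → Tm Γ (nat ⇒ J R X) →
                Tm Γ nat → Tm Γ (nat ⇒ X) → Tm Γ (X ⇒ R) → Fm Γ
SpectorSystem q ω ε n α p =
  (n ≐ ω · α) ∧ (α · n ≐ ε · n · p) ∧ (p · (α · n) ≐ q · α)

{-# OPTIONS --safe #-}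

-- Put q′(α) = (q(α), ω(α)) and ε′ₙ(p) = εₙ(fst ∘ p), and let α = eps₀(ε′)(q′)
-- with control ℓ = snd. By induction on k, as long as ω(α) ≥ k, there is a
-- prefixing map t (β ↦ s * β with s of length k) with
-- α = t(eps_k(ε′)(q′ ∘ t)): were the control to stop at k, then
-- eps_k(ε′)(q′ ∘ t) = 𝟎 and ω(α) = ω(t 𝟎) < k. Unfolding eps once more at
-- k = ω(α) yields p(x) = q(t(x * eps_{k+1}(ε′)(q′ ∘ t ∘ (x *_)))).
module Submission where

open import Defs
open import Data.List.Base using (List; []; _∷_; map)
open import Data.List.Membership.Propositional using (_∈_)
open import Data.List.Relation.Unary.Any using (here; there)
open import Data.Nat.Base using (ℕ; zero; suc)
open import Data.Product.Base using (Σ-syntax; _,_; proj₁; proj₂)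
open import Relation.Binary.PropositionalEquality
  using (_≡_; refl; sym; cong; cong₂; subst; subst₂)

private variable
  Γ Δ : Ctx
  X Y R : Ty
  Θ : List (Fm Γ)

-- Any left inverse `σ` of `ρ` is allowed, so that the induction can pass under binders, where both
-- are lifted.
sub-ren-id : {ρ : Ren Γ Δ} {σ : Sub Δ Γ} →
             (∀ {Y} (x : Y ∈ Γ) → σ (ρ x) ≡ var x) →
             (t : Tm Γ X) → sub σ (ren ρ t) ≡ t
sub-ren-id h (var x) = h x
sub-ren-id h (con c) = refl
sub-ren-id h (ƛ t)   = cong ƛ_ (sub-ren-id
  (λ { (here e) → refl ; (there x) → cong wk (h x) }) t)
sub-ren-id h (s · t) = cong₂ _·_ (sub-ren-id h s) (sub-ren-id h t)

sub-wk : {s : Tm Γ Y} (t : Tm Γ X) → sub (s ▹ var) (wk t) ≡ t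
sub-wk = sub-ren-id (λ _ → refl)

-- Derived rules of equality.

≐-sym : {s t : Tm Γ X} → Θ ⊢ s ≐ t → Θ ⊢ t ≐ s
≐-sym {Θ = Θ} {s} {t} e =
  subst (λ u → Θ ⊢ t ≐ u) (sub-wk s)
    (≐-subst (v0 ≐ wk s) e (subst (λ u → Θ ⊢ s ≐ u) (sym (sub-wk s)) ≐-refl))

≐-trans : {s t u : Tm Γ X} → Θ ⊢ s ≐ t → Θ ⊢ t ≐ u → Θ ⊢ s ≐ u
≐-trans {Θ = Θ} {s} {t} {u} e e′ =
  subst (λ r → Θ ⊢ r ≐ u) (sub-wk s)
    (≐-subst (wk s ≐ v0) e′ (subst (λ r → Θ ⊢ r ≐ t) (sym (sub-wk s)) e))

≐-congˡ : {f g : Tm Γ (X ⇒ Y)} {s : Tm Γ X} → Θ ⊢ f ≐ g → Θ ⊢ f · s ≐ g · s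
≐-congˡ {Θ = Θ} {f} {g} {s} e =
  subst₂ (λ f′ s′ → Θ ⊢ f′ · s′ ≐ g · s′) (sub-wk f) (sub-wk s)
    (≐-subst (wk f · wk s ≐ v0 · wk s) e
      (subst (λ f′ → Θ ⊢ f′ · sub (f ▹ var) (wk s) ≐ f · sub (f ▹ var) (wk s))
        (sym (sub-wk f)) ≐-refl))

≐-congʳ : {f : Tm Γ (X ⇒ Y)} {s t : Tm Γ X} → Θ ⊢ s ≐ t → Θ ⊢ f · s ≐ f · t
≐-congʳ {Θ = Θ} {f} {s} {t} e =
  subst₂ (λ f′ s′ → Θ ⊢ f′ · s′ ≐ f′ · t) (sub-wk f) (sub-wk s)
    (≐-subst (wk f · wk s ≐ wk f · v0) e
      (subst (λ s′ → Θ ⊢ sub (s ▹ var) (wk f) · s′ ≐ sub (s ▹ var) (wk f) · s)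
        (sym (sub-wk s)) ≐-refl))

wk-app : (t : Tm (X ∷ Γ) Y) → Θ ⊢ wk (ƛ t) · v0 ≐ t
wk-app {Θ = Θ} t = subst (λ u → Θ ⊢ wk (ƛ t) · v0 ≐ u)
  (sub-ren-id (λ { (here refl) → refl ; (there x) → refl }) t) (β _ _)

-- This is what lets `reduce` work under binders.
ξ : {t u : Tm (X ∷ Γ) Y} → map wkF Θ ⊢ t ≐ u → Θ ⊢ (ƛ t) ≐ (ƛ u)
ξ {t = t} {u} e = ext (∀I (≐-trans (wk-app t) (≐-trans e (≐-sym (wk-app u)))))

infix  3 _∎
infixr 2 _≐⟨_⟩_

_≐⟨_⟩_ : (s : Tm Γ X) {t u : Tm Γ X} → Θ ⊢ s ≐ t → Θ ⊢ t ≐ u → Θ ⊢ s ≐ u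
s ≐⟨ e ⟩ e′ = ≐-trans e e′

_∎ : (s : Tm Γ X) → Θ ⊢ s ≐ s
s ∎ = ≐-refl

-- Conversions are proved by reflection: both sides are parallel-reduced to a
-- common term; eps is never unfolded.

Reduct : Tm Γ X → Set
Reduct {Γ} {X} t = Σ[ u ∈ Tm Γ X ] (∀ {Θ} → Θ ⊢ t ≐ u)

contract : (f : Tm Γ (X ⇒ Y)) (s : Tm Γ X) → Reduct (f · s)
contract (ƛ t) s = sub (s ▹ var) t , β t s
contract (con natrec · x · f) (con O)     = x , natrec-O
contract (con natrec · x · f) (con S · n) = f · n · (con natrec · x · f · n) , natrec-S
contract (con fst) (con pair · x · y) = x , fst-pair
contract (con snd) (con pair · x · y) = y , snd-pair
contract f s = f · s , ≐-refl

reduce : (t : Tm Γ X) → Reduct t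
reduce (var x) = var x , ≐-refl
reduce (con c) = con c , ≐-refl
reduce (ƛ t)   = let u , e = reduce t in (ƛ u) , ξ e
reduce (f · s) =
  let g , e  = reduce f
      u , e′ = reduce s
      r , e″ = contract g u
  in  r , ≐-trans (≐-congˡ e) (≐-trans (≐-congʳ e′) e″)

reduces : ℕ → (t : Tm Γ X) → Reduct t
reduces zero    t = t , ≐-refl
reduces (suc m) t =
  let u , e  = reduce t
      r , e′ = reduces m u
  in  r , ≐-trans e e′

-- `m` counts the rounds run on each side; a `refl` at the call compares the results.
convert : ∀ m {s t : Tm Γ X} →
          proj₁ (reduces m s) ≡ proj₁ (reduces m t) → Θ ⊢ s ≐ t
convert {Θ = Θ} m {s} {t} e =
  ≐-trans (proj₂ (reduces m s)) (subst (λ u → Θ ⊢ u ≐ t) (sym e) (≐-sym (proj₂ (reduces m t))))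

-- Addition and order inside the object theory.

O+ : Θ ⊢ ∀[ nat ] con O + v0 ≐ v0
O+ = nat-ind (con O + v0 ≐ v0) natrec-O
  (∀I (⊃I (≐-trans (convert 3 refl) (≐-congʳ {f = con S} (hyp (here refl))))))

-- Addition recurses on its right argument, so a successor on the left moves out only by induction.
S+ : Θ ⊢ ∀[ nat ] ∀[ nat ] con S · v1 + v0 ≐ con S · (v1 + v0)
S+ = ∀I (nat-ind (con S · v1 + v0 ≐ con S · (v1 + v0)) (convert 3 refl)
  (∀I (⊃I (
    con S · v1 + con S · v0    ≐⟨ convert 3 refl ⟩
    con S · (con S · v1 + v0)  ≐⟨ ≐-congʳ (hyp (here refl)) ⟩
    con S · (con S · (v1 + v0)) ≐⟨ convert 3 refl ⟩
    con S · (v1 + con S · v0)  ∎))))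

<-irrefl : Θ ⊢ ∀[ nat ] ¬ (v0 < v0)
<-irrefl = nat-ind (¬ (v0 < v0))
  (⊃I (∃E (hyp (here refl))
    (⊃E (S≢O {n = con O + v0}) (≐-trans (≐-sym (convert 3 refl)) (hyp (here refl))))))
  (∀I (⊃I (⊃I (∃E (hyp (here refl))
    -- The witness is kept: `S-inj` cancels one successor and `S+` shifts the other to the right
    -- summand.
    (⊃E (hyp (there (there (here refl)))) (∃I v0 (
      v1 + con S · v0      ≐⟨ convert 3 refl ⟩
      con S · (v1 + v0)    ≐⟨ ≐-sym (∀E (∀E S+ v1) v0) ⟩
      con S · v1 + v0      ≐⟨ ⊃E S-inj (≐-trans (≐-sym (convert 3 refl)) (hyp (here refl))) ⟩
      v1 ∎)))))))

-- Used contrapositively: if `ω(α)` is not below `k + 1`, it is not below `k`.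
<-step : Θ ⊢ ∀[ nat ] ∀[ nat ] (v1 < v0 ⊃ v1 < con S · v0)
<-step = ∀I (∀I (⊃I (∃E (hyp (here refl)) (∃I (con S · v0)
  (≐-trans (convert 3 refl) (≐-congʳ {f = con S} (hyp (here refl))))))))

-- The sequence `path` and its prefixes.

observe : Tm Γ ((nat ⇒ X) ⇒ R) → Tm Γ ((nat ⇒ X) ⇒ nat) → Tm Γ ((nat ⇒ X) ⇒ R ⊗ nat)
observe q ω = ƛ con pair · (wk q · v0) · (wk ω · v0)

select : Tm Γ (nat ⇒ J R X) → Tm Γ (nat ⇒ J (R ⊗ nat) X)
select ε = ƛ ƛ wk (wk ε) · v1 · (ƛ con fst · (v1 · v0))

module _ (q : Tm Γ ((nat ⇒ X) ⇒ R)) (ω : Tm Γ ((nat ⇒ X) ⇒ nat)) (ε : Tm Γ (nat ⇒ J R X)) where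

  path : Tm Γ (nat ⇒ X)
  path = con eps · con snd · con O · select ε · observe q ω

  rest : Tm Γ nat → Tm Γ ((nat ⇒ X) ⇒ (nat ⇒ X)) → Tm Γ (nat ⇒ X)
  rest k t = con eps · con snd · k · select ε · (ƛ wk (observe q ω) · (wk t · v0))

-- With prefixes kept as maps rather than finite sequences, appending an element is composition with
-- `x *_` on the inside.
extend : Tm Γ ((nat ⇒ X) ⇒ (nat ⇒ X)) → Tm Γ X → Tm Γ ((nat ⇒ X) ⇒ (nat ⇒ X))
extend t x = ƛ wk t · (wk x * v0)

module _ (q : Tm Γ ((nat ⇒ X) ⇒ R)) (ω : Tm Γ ((nat ⇒ X) ⇒ nat)) (ε : Tm Γ (nat ⇒ J R X))
         (k : Tm Γ nat) where

  outcome : Tm Γ ((nat ⇒ X) ⇒ (nat ⇒ X)) → Tm Γ (X ⇒ R)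
  outcome t = ƛ wk q · (wk t · (v0 * rest (wk q) (wk ω) (wk ε) (con S · wk k) (extend (wk t) v0)))

  choice : Tm Γ ((nat ⇒ X) ⇒ (nat ⇒ X)) → Tm Γ X
  choice t = ε · k · outcome t

  -- The last conjunct is all that is recorded of the prefix having length `k`: from position `k`
  -- on, `t β` reads `β`.
  Invariant : Fm Γ
  Invariant = ¬ (ω · path q ω ε < k) ⊃ (∃[ (nat ⇒ X) ⇒ (nat ⇒ X) ]
    path (wk q) (wk ω) (wk ε) ≐ v0 · rest (wk q) (wk ω) (wk ε) (wk k) v0
    ∧ (∀[ nat ⇒ X ] ∀[ nat ] v2 · v1 · (wk (wk (wk k)) + v0) ≐ v1 · v0))

-- The parameters are variables rather than terms, so that substitutions into
-- the formulas below compute.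
module _ (q : (nat ⇒ X) ⇒ R ∈ Γ) (ω : (nat ⇒ X) ⇒ nat ∈ Γ) (ε : nat ⇒ J R X ∈ Γ) where

  private
    q₂ : ∀ {Y Z} → Tm (Z ∷ Y ∷ Γ) ((nat ⇒ X) ⇒ R)
    q₂ = wk (wk (var q))
    ω₂ : ∀ {Y Z} → Tm (Z ∷ Y ∷ Γ) ((nat ⇒ X) ⇒ nat)
    ω₂ = wk (wk (var ω))
    ε₂ : ∀ {Y Z} → Tm (Z ∷ Y ∷ Γ) (nat ⇒ J R X)
    ε₂ = wk (wk (var ε))

  -- Serves both the induction step of `path-invariant` and the final unfolding at `k = ω(α)`.
  path-unfold : Θ ⊢ ∀[ nat ] ∀[ (nat ⇒ X) ⇒ (nat ⇒ X) ]
    (path q₂ ω₂ ε₂ ≐ v0 · rest q₂ ω₂ ε₂ v1 v0 ⊃ ¬ (ω₂ · path q₂ ω₂ ε₂ < v1) ⊃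
     path q₂ ω₂ ε₂ ≐ v0 · (choice q₂ ω₂ ε₂ v1 v0
                            * rest q₂ ω₂ ε₂ (con S · v1) (extend v0 (choice q₂ ω₂ ε₂ v1 v0))))
  path-unfold = ∀I (∀I (⊃I (⊃I (
      path q₂ ω₂ ε₂            ≐⟨ hyp (there (here refl)) ⟩
      v0 · rest q₂ ω₂ ε₂ v1 v0 ≐⟨ ≐-congʳ (⊃E (∧E₂ defining) (⊃I not-stopped)) ⟩
      -- `fst` discards the control component, turning the argument passed to `ε` into `outcome`.
      v0 · _                   ≐⟨ convert 8 refl ⟩
      v0 · (choice q₂ ω₂ ε₂ v1 v0
             * rest q₂ ω₂ ε₂ (con S · v1) (extend v0 (choice q₂ ω₂ ε₂ v1 v0))) ∎))))
    where
    defining : ∀ {Θ} → Θ ⊢ EpsEq (con snd) v1 (select ε₂) (ƛ wk (observe q₂ ω₂) · (v1 · v0))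
    defining = eps-eq _ _ _ _
    stop : Fm _
    stop = con snd · ((ƛ wk (observe q₂ ω₂) · (v1 · v0)) · 𝟎 (nat ⇒ X)) < v1
    not-stopped : ∀ {Θ} → stop
                    ∷ ¬ (ω₂ · path q₂ ω₂ ε₂ < v1)
                    ∷ path q₂ ω₂ ε₂ ≐ v0 · rest q₂ ω₂ ε₂ v1 v0
                    ∷ Θ ⊢ ⊥
    not-stopped = ⊃E (hyp (there (here refl))) (≐-subst (v0 < v2)
      (con snd · ((ƛ wk (observe q₂ ω₂) · (v1 · v0)) · 𝟎 (nat ⇒ X))
                                      ≐⟨ convert 5 refl ⟩
       ω₂ · (v0 · 𝟎 (nat ⇒ X))        ≐⟨ ≐-congʳ (≐-congʳ (≐-sym (⊃E (∧E₁ defining) (hyp (here refl))))) ⟩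
       ω₂ · (v0 · rest q₂ ω₂ ε₂ v1 v0) ≐⟨ ≐-congʳ (≐-sym (hyp (there (there (here refl))))) ⟩
       ω₂ · path q₂ ω₂ ε₂             ∎)
      (hyp (here refl)))

path-invariant : (q : (nat ⇒ X) ⇒ R ∈ Γ) (ω : (nat ⇒ X) ⇒ nat ∈ Γ) (ε : nat ⇒ J R X ∈ Γ) →
  Θ ⊢ ∀[ nat ] Invariant (wk (var q)) (wk (var ω)) (wk (var ε)) v0
path-invariant q ω ε = nat-ind (Invariant (wk (var q)) (wk (var ω)) (wk (var ε)) v0)
  -- The empty prefix is the identity; as `observe` is an abstraction, composing with it reduces
  -- back without η.
  (⊃I (∃I (ƛ v0) (∧I (convert 8 refl)
    (∀I (∀I (≐-trans (≐-congˡ (β _ _)) (≐-congʳ (∀E O+ v0))))))))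
  (∀I (⊃I (⊃I (∃E
    (⊃E (hyp (there (here refl)))
      (⊃I (⊃E (hyp (there (here refl))) (⊃E (∀E (∀E <-step n) v0) (hyp (here refl))))))
    (∃I (extend v0 c) (∧I
      (≐-trans
        (⊃E (⊃E (∀E (∀E (path-unfold _ _ _) v1) v0) (∧E₁ (hyp (here refl))))
            (⊃I (⊃E (hyp (there (there (here refl))))
                    (⊃E (∀E (∀E <-step (wk n)) v1) (hyp (here refl))))))
        (convert 8 refl))
      -- Position `(k + 1) + i` becomes `k + (i + 1)`, so the old prefix property applies to
      -- `c * β`, whose head is then skipped.
      (∀I (∀I (
        wk (wk (extend v0 c)) · v1 · (con S · v3 + v0) ≐⟨ ≐-congˡ (β _ _) ⟩
        v2 · (wk (wk c) * v1) · (con S · v3 + v0)      ≐⟨ ≐-congʳ (∀E (∀E S+ v3) v0) ⟩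
        v2 · (wk (wk c) * v1) · (con S · (v3 + v0))    ≐⟨ ≐-congʳ (≐-sym (convert 3 refl)) ⟩
        v2 · (wk (wk c) * v1) · (v3 + con S · v0)
          ≐⟨ ∀E (∀E (∧E₂ (hyp (here refl))) (wk (wk c) * v1)) (con S · v0) ⟩
        (wk (wk c) * v1) · (con S · v0)                ≐⟨ convert 8 refl ⟩
        v1 · v0                                        ∎)))))))))
  where
  n = wk (var ω) · path (wk (var q)) (wk (var ω)) (wk (var ε))
  c = choice (wk (wk (var q))) (wk (wk (var ω))) (wk (wk (var ε))) v1 v0

corollary3p9 : (X R : Ty) →
    [] {A = Fm []} ⊢
    ∀[ (nat ⇒ X) ⇒ R ] ∀[ (nat ⇒ X) ⇒ nat ] ∀[ nat ⇒ J R X ]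
    ∃[ nat ] ∃[ nat ⇒ X ] ∃[ X ⇒ R ]
    SpectorSystem v5 v4 v3 v2 v1 v0
corollary3p9 X R = ∀I (∀I (∀I (∃E
  -- At `k = ω(α)` itself, irreflexivity discharges the premise of the invariant.
  (⊃E (∀E (path-invariant (there (there (here refl))) (there (here refl)) (here refl)) (v1 · path v2 v1 v0))
      (∀E <-irrefl _))
  -- A cut makes the unfolded equation for `α` a hypothesis, since the last two equations both rely
  -- on it.
  (∃I n (∃I α (∃I p (⊃E (⊃I equations)
    (⊃E (⊃E (∀E (∀E (path-unfold (there (there (there (here refl)))) (there (there (here refl))) (there (here refl))) n) v0)
            (∧E₁ (hyp (here refl))))
        (∀E <-irrefl n)))))))))
  where
  α = path v3 v2 v1
  n = v2 · α
  p = outcome v3 v2 v1 n v0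
  c = choice v3 v2 v1 n v0
  β′ = c * rest v3 v2 v1 (con S · n) (extend v0 c)

  equations : ∀ {φ Θ} → (α ≐ v0 · β′)
                ∷ (φ ∧ (∀[ nat ⇒ X ] ∀[ nat ] v2 · v1 · (wk (wk n) + v0) ≐ v1 · v0))
                ∷ Θ ⊢ SpectorSystem v3 v2 v1 n α p
  equations = ∧I ≐-refl (∧I α-n (
      p · (α · n)          ≐⟨ ≐-congʳ α-n ⟩
      -- Putting `c` for the argument of `outcome` recreates `β′`.
      p · c                ≐⟨ convert 8 refl ⟩
      v3 · (v0 · β′)       ≐⟨ ≐-congʳ (≐-sym (hyp (here refl))) ⟩
      v3 · α               ∎))
    where
    α-n =
      -- Offset `O` after a prefix of length `n` picks out the head of `β′`.
      α · n                ≐⟨ convert 8 refl ⟩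
      α · (n + con O)      ≐⟨ ≐-congˡ (hyp (here refl)) ⟩
      v0 · β′ · (n + con O) ≐⟨ ∀E (∀E (∧E₂ (hyp (there (here refl)))) β′) (con O) ⟩
      β′ · con O           ≐⟨ natrec-O ⟩
      c                    ∎
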